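{- Let $p$ be an odd prime and let $B$ be a non-empty subset of $\mathbb Z_p$. (i) If $p\equiv 1\pmod 4$ and $0\notin B$, then $D_{Q_p,B}=4$ or $D_{Q_p,B}=5$. (ii) If $p\equiv 3\pmod 4$ and $B\subseteq Q_p$, then $D_{Q_p,B}=5$.
   Context: For an odd prime $p$, $\mathbb Z_p=\mathbb Z/p\mathbb Z$, $U(p)$ is its group of units, and $Q_p=\{x^2:x\in U(p)\}$. A sequence of length $k$ in $\mathbb Z_p$ is an element of $\mathbb Z_p^k$. For a non-empty $B\subseteq\mathbb Z_p$, a sequence $(x_1,\ldots,x_k)$ in $\mathbb Z_p$ is called a $(Q_p,B)$-weighted zero-sum sequence if there exist $a_1,\ldots,a_k\in Q_p$ and $b_1,\ldots,b_k\in B$ such that $a_1x_1+\cdots+a_kx_k=0$ and $b_1a_1+\cdots+b_ka_k=0$ in $\mathbb Z_p$. The constant $D_{Q_p,B}$ is the least positive integer $k$ such that every sequence in $\mathbb Z_p$ of length $k$ has a (non-empty) $(Q_p,B)$-weighted zero-sum subsequence (terms not necessarily consecutive). -}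

module Defs where

open import Data.Fin.Base using (Fin; toℕ)
open import Data.Fin.Subset using (Subset; _∈_)
open import Data.List.Relation.Binary.Sublist.Propositional using (_⊆_)
open import Data.Nat.Base as ℕ using (ℕ; NonZero; _≤_)
open import Data.Nat.DivMod using (_mod_)
open import Data.Product.Base using (Σ-syntax; ∃-syntax; ∃₂; _×_)
open import Data.Vec.Base using (Vec; foldr′; zipWith; toList)
open import Data.Vec.Relation.Unary.All using (All)
open import Relation.Binary.PropositionalEquality.Core using (_≡_)

-- ℤ/pℤ is represented by its canonical residues, so propositional equality
-- on `Fin p` is equality in ℤ/pℤ and `Subset p` is the type of its subsets.
module ModP (p : ℕ) .{{_ : NonZero p}} where

  ℤₚ : Set
  ℤₚ = Fin p

  infixl 6 _+_
  infixl 7 _*_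

  _+_ _*_ : ℤₚ → ℤₚ → ℤₚ
  x + y = (toℕ x ℕ.+ toℕ y) mod p
  x * y = (toℕ x ℕ.* toℕ y) mod p

  0ₚ 1ₚ : ℤₚ
  0ₚ = 0 mod p
  1ₚ = 1 mod p

  sum : ∀ {k} → Vec ℤₚ k → ℤₚ
  sum = foldr′ _+_ 0ₚ

  U : ℤₚ → Set
  U x = ∃[ y ] x * y ≡ 1ₚ

  Q : ℤₚ → Set
  Q y = ∃[ x ] U x × y ≡ x * x

  WeightedZeroSum : Subset p → ∀ {k} → Vec ℤₚ k → Set
  WeightedZeroSum B {k} xs = ∃₂ λ (as bs : Vec ℤₚ k) →
    All Q as × All (_∈ B) bs ×
    sum (zipWith _*_ as xs) ≡ 0ₚ × sum (zipWith _*_ bs as) ≡ 0ₚ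

  -- `_⊆_` on lists is the order-preserving embedding relation, so repeated
  -- terms are used at most as often as they occur and need not be consecutive.
  HasZeroSumSubsequence : Subset p → ∀ {k} → Vec ℤₚ k → Set
  HasZeroSumSubsequence B xs = ∃[ m ] Σ[ ys ∈ Vec ℤₚ m ]
    1 ≤ m × toList ys ⊆ toList xs × WeightedZeroSum B ys

  AllHaveZeroSumSubsequence : Subset p → ℕ → Set
  AllHaveZeroSumSubsequence B k = (xs : Vec ℤₚ k) → HasZeroSumSubsequence B xs

  -- The constant is given by its graph: `D B ≔ k` states that the least such
  -- positive integer exists and equals k.
  D_≔_ : Subset p → ℕ → Set
  D B ≔ k = 1 ≤ k × AllHaveZeroSumSubsequence B k ×
    (∀ j → 1 ≤ j → AllHaveZeroSumSubsequence B j → k ≤ j)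

{-# OPTIONS --safe #-}
-- Upper bound: adding b ∈ B as a constant second weight turns the problem into
-- finding a common nontrivial zero of the forms Σ uᵢ² xᵢ and Σ uᵢ² b, and by
-- Chevalley's theorem two quadratic forms in 5 > 2 + 2 variables have one.
-- Chevalley's theorem comes from the fact that the sum of a polynomial of
-- degree below n(p-1) over {0, …, p-1}ⁿ vanishes modulo p: by Newton's
-- forward-difference formula, summing over one variable amounts, modulo p, to
-- taking its (p-1)-st difference, which lowers the degree by p-1.
-- Lower bounds: (0, 1, g) with -g a non-square has no weighted zero-sum
-- subsequence if 0 ∉ B, and neither does (0, 0, 1, 1) if B ⊆ Q and -1 is a
-- non-square.
module Submission where

open import Defs
open import Data.Fin.Subset using (Subset; Nonempty; _∈_; _∉_)
open import Data.Nat.Base using (ℕ; _%_)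
open import Data.Nat.Divisibility using (_∤_)
open import Data.Nat.Primality using (Prime; prime⇒nonZero)
open import Data.Product.Base using (_×_)
open import Data.Sum.Base using (_⊎_)
open import Relation.Binary.PropositionalEquality.Core using (_≡_)

open import Data.Fin.Base using (Fin; zero; suc; toℕ; fromℕ<)
open import Data.Fin.Properties
  using (any?; all?; toℕ-injective; toℕ<n; toℕ-fromℕ<; fromℕ<-injective; injective⇒≤)
open import Data.Fin.Subset.Properties using (_∈?_)
open import Data.Integer.Base using (ℤ; +_; 0ℤ; 1ℤ; _+_; _*_; _-_; -_; _^_)
import Data.Integer.Divisibility.Signed as ℤ∣
open ℤ∣ using () renaming (_∣_ to _∣ℤ_)
import Data.Integer.Properties as ℤ
import Data.Integer.Tactic.RingSolver as ℤ-Solver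
open import Data.List.Relation.Binary.Sublist.Propositional using (_⊆_; []; _∷_; _∷ʳ_; ⊆-trans; minimum)
open import Data.Nat.Base as ℕ using (NonZero; zero; suc; s≤s; z≤n; _<_; _≤_; pred)
open import Data.Nat.Combinatorics using (_C_; nC1≡n; nCn≡1; k>n⇒nCk≡0; nCk+nC[k+1]≡[n+1]C[k+1])
open import Data.Nat.Divisibility
  using (_∣_; _∣?_; divides; >⇒∤; ∣m⇒∣m*n; ∣n⇒∣m*n; m∣m*n; n∣m*n; ∣m∣n⇒∣m+n; ∣m+n∣m⇒∣n; m%n≡0⇒n∣m; n∣m⇒m%n≡0)
open import Data.Nat.DivMod using (_mod_; %-distribˡ-+; %-distribˡ-*; %-remove-+ˡ; m<n⇒m%n≡m; m≡m%n+[m/n]*n)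
open import Data.Nat.Primality using (euclidsLemma; prime⇒nonTrivial; ¬prime[0]; ¬prime[1])
import Data.Nat.Properties as ℕ
import Data.Nat.Tactic.RingSolver as ℕ-Solver
open import Data.Product.Base using (_,_; ∃; ∃₂; proj₁; proj₂)
open import Data.Sum.Base using (inj₁; inj₂; [_,_]′)
open import Data.Vec.Base using (Vec; []; _∷_; head; tail; updateAt; replicate; map; zipWith; toList; truncate)
open import Data.Vec.Relation.Unary.All as VecAll using (All; []; _∷_)
open import Data.Vec.Relation.Unary.Any as VecAny using (Any; here; there)
import Data.Vec.Relation.Unary.Any.Properties as VecAny using (map⁻)
open import Function.Base using (_∘_)
open import Relation.Binary.PropositionalEquality
  using (refl; sym; trans; cong; cong₂; subst; module ≡-Reasoning)
open import Relation.Nullary using (¬_; Dec; yes; no; contradiction; ¬?; _×-dec_; map′)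
open import Relation.Nullary.Decidable using (decidable-stable)

open ≡-Reasoning

-- Finite differences modulo a prime

∑ : (ℕ → ℤ) → ℕ → ℤ
∑ f zero    = 0ℤ
∑ f (suc n) = ∑ f n + f n

∑-cong : ∀ {f g} → (∀ k → f k ≡ g k) → ∀ n → ∑ f n ≡ ∑ g n
∑-cong f≗g zero    = refl
∑-cong f≗g (suc n) = cong₂ _+_ (∑-cong f≗g n) (f≗g n)

∑-head : ∀ f n → ∑ f (suc n) ≡ f 0 + ∑ (f ∘ suc) n
∑-head f zero    = ℤ.+-comm 0ℤ (f 0)
∑-head f (suc n) = trans (cong (_+ f (suc n)) (∑-head f n))
  (ℤ.+-assoc (f 0) (∑ (f ∘ suc) n) (f (suc n)))

∑-∣ : ∀ {d f} n → (∀ k → k < n → d ∣ℤ f k) → d ∣ℤ ∑ f n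
∑-∣ {d} zero    d∣f = ℤ∣.divides 0ℤ refl
∑-∣     (suc n) d∣f = ℤ∣.∣m∣n⇒∣m+n (∑-∣ n λ k k<n → d∣f k (ℕ.m<n⇒m<1+n k<n)) (d∣f n ℕ.≤-refl)

∑-minus : ∀ f g n → ∑ f n - ∑ g n ≡ ∑ (λ k → f k - g k) n
∑-minus f g zero    = refl
∑-minus f g (suc n) = trans (interchange (∑ f n) (f n) (∑ g n) (g n))
  (cong (_+ (f n - g n)) (∑-minus f g n))
  where
  interchange : ∀ a b c d → (a + b) - (c + d) ≡ (a - c) + (b - d)
  interchange = ℤ-Solver.solve-∀

∣-resp-difference : ∀ {d a b} → d ∣ℤ a - b → d ∣ℤ b → d ∣ℤ a
∣-resp-difference {a = a} {b} d∣a-b d∣b = subst (_ ∣ℤ_) (cancel a b) (ℤ∣.∣m∣n⇒∣m+n d∣a-b d∣b)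
  where
  cancel : ∀ a b → (a - b) + b ≡ a
  cancel = ℤ-Solver.solve-∀

Δ : (ℕ → ℤ) → ℕ → ℤ
Δ f n = f (suc n) - f n

Δ^ : ℕ → (ℕ → ℤ) → ℕ → ℤ
Δ^ zero    f = f
Δ^ (suc k) f = Δ^ k (Δ f)

Δ^-cong : ∀ k {f g} → (∀ n → f n ≡ g n) → ∀ n → Δ^ k f n ≡ Δ^ k g n
Δ^-cong zero    f≗g = f≗g
Δ^-cong (suc k) f≗g = Δ^-cong k λ n → cong₂ _-_ (f≗g (suc n)) (f≗g n)

-- `Δ^` applies the additional difference first; applying it last instead relates iterated
-- differences at neighbouring points.
Δ^-suc : ∀ k f n → Δ^ (suc k) f n ≡ Δ^ k f (suc n) - Δ^ k f n
Δ^-suc zero    f n = refl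
Δ^-suc (suc k) f n = Δ^-suc k (Δ f) n

Δ^-∘suc : ∀ k f n → Δ^ k (f ∘ suc) n ≡ Δ^ k f (suc n)
Δ^-∘suc zero    f n = refl
Δ^-∘suc (suc k) f n = Δ^-∘suc k (Δ f) n

-- Pascal's rule for a sum cut off at `m`. The separate term `+ (n C m) * D m` is the half of the
-- last coefficient that the cut-off leaves unpaired; carrying it along makes induction on `m`
-- possible.
pascal-∑ : ∀ (D : ℕ → ℤ) n m →
  ∑ (λ k → + (n C k) * (D k + D (suc k))) m + + (n C m) * D m ≡
  ∑ (λ k → + (suc n C k) * D k) (suc m)
pascal-∑ D n zero    = refl
pascal-∑ D n (suc m) = begin
  (S + + (n C m) * (D m + D (suc m))) + + (n C suc m) * D (suc m)
    ≡⟨ regroup S (+ (n C m)) (+ (n C suc m)) (D m) (D (suc m)) ⟩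
  (S + + (n C m) * D m) + (+ (n C m) + + (n C suc m)) * D (suc m)
    ≡⟨ cong₂ (λ x y → x + y * D (suc m)) (pascal-∑ D n m)
         (trans (sym (ℤ.pos-+ (n C m) (n C suc m))) (cong +_ (nCk+nC[k+1]≡[n+1]C[k+1] n m))) ⟩
  ∑ (λ k → + (suc n C k) * D k) (suc (suc m)) ∎
  where
  S = ∑ (λ k → + (n C k) * (D k + D (suc k))) m
  regroup : ∀ s c c′ d e → (s + c * (d + e)) + c′ * e ≡ (s + c * d) + (c + c′) * e
  regroup = ℤ-Solver.solve-∀

-- Newton's forward-difference formula. The induction applies the formula for `n` to the shifted
-- function, whose `k`-th difference at `0` is `D k + D (suc k)`, and Pascal's rule recombines the
-- coefficients.
newton : ∀ n f → f n ≡ ∑ (λ k → + (n C k) * Δ^ k f 0) (suc n)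
newton zero    f = only-term (f 0)
  where
  only-term : ∀ a → a ≡ 0ℤ + 1ℤ * a
  only-term = ℤ-Solver.solve-∀
newton (suc n) f = begin
  f (suc n)
    ≡⟨ newton n (f ∘ suc) ⟩
  ∑ (λ k → + (n C k) * Δ^ k (f ∘ suc) 0) (suc n)
    ≡⟨ ∑-cong (λ k → cong (+ (n C k) *_) (split k)) (suc n) ⟩
  S
    -- The coefficient `n C suc n` is zero, so it can be inserted as the boundary term that
    -- `pascal-∑` expects.
    ≡⟨ drop-zero S (D (suc n)) ⟨
  S + 0ℤ * D (suc n)
    ≡⟨ cong (λ c → S + + c * D (suc n)) (k>n⇒nCk≡0 (ℕ.n<1+n n)) ⟨
  S + + (n C suc n) * D (suc n)
    ≡⟨ pascal-∑ D n (suc n) ⟩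
  ∑ (λ k → + (suc n C k) * D k) (suc (suc n)) ∎
  where
  D : ℕ → ℤ
  D k = Δ^ k f 0
  S = ∑ (λ k → + (n C k) * (D k + D (suc k))) (suc n)
  drop-zero : ∀ s d → s + 0ℤ * d ≡ s
  drop-zero = ℤ-Solver.solve-∀
  step : ∀ a b → b ≡ a + (b - a)
  step = ℤ-Solver.solve-∀
  split : ∀ k → Δ^ k (f ∘ suc) 0 ≡ D k + D (suc k)
  split k = begin
    Δ^ k (f ∘ suc) 0             ≡⟨ Δ^-∘suc k f 0 ⟩
    Δ^ k f 1                     ≡⟨ step (D k) (Δ^ k f 1) ⟩
    D k + (Δ^ k f 1 - D k)       ≡⟨ cong (_+_ (D k)) (Δ^-suc k f 0) ⟨
    D k + D (suc k)              ∎

-- The absorption identity, by Pascal's rule and induction on `n`. It exhibits the factor `p` in the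
-- binomial coefficients of `p`.
[1+k]*[1+n]C[1+k]≡[1+n]*nCk : ∀ n k → suc k ℕ.* (suc n C suc k) ≡ suc n ℕ.* (n C k)
[1+k]*[1+n]C[1+k]≡[1+n]*nCk n       zero    =
  trans (ℕ.*-identityˡ (suc n C 1)) (trans (nC1≡n (suc n)) (sym (ℕ.*-identityʳ (suc n))))
[1+k]*[1+n]C[1+k]≡[1+n]*nCk zero    (suc k) =
  trans (cong (suc (suc k) ℕ.*_) (k>n⇒nCk≡0 {1} {suc (suc k)} (s≤s (s≤s z≤n))))
    (trans (ℕ.*-zeroʳ (suc (suc k))) (sym (cong (1 ℕ.*_) (k>n⇒nCk≡0 {0} {suc k} (s≤s z≤n)))))
[1+k]*[1+n]C[1+k]≡[1+n]*nCk (suc n) (suc k) = begin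
  suc (suc k) ℕ.* (suc (suc n) C suc (suc k))
    ≡⟨ cong (suc (suc k) ℕ.*_) (nCk+nC[k+1]≡[n+1]C[k+1] (suc n) (suc k)) ⟨
  suc (suc k) ℕ.* (A ℕ.+ B)
    ≡⟨ expand k A B ⟩
  A ℕ.+ (suc k ℕ.* A ℕ.+ suc (suc k) ℕ.* B)
    ≡⟨ cong (A ℕ.+_) (cong₂ ℕ._+_ ([1+k]*[1+n]C[1+k]≡[1+n]*nCk n k) ([1+k]*[1+n]C[1+k]≡[1+n]*nCk n (suc k))) ⟩
  A ℕ.+ (suc n ℕ.* (n C k) ℕ.+ suc n ℕ.* (n C suc k))
    ≡⟨ cong (A ℕ.+_) (ℕ.*-distribˡ-+ (suc n) (n C k) (n C suc k)) ⟨
  A ℕ.+ suc n ℕ.* (n C k ℕ.+ n C suc k)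
    ≡⟨ cong (λ c → A ℕ.+ suc n ℕ.* c) (nCk+nC[k+1]≡[n+1]C[k+1] n k) ⟩
  suc (suc n) ℕ.* A ∎
  where
  A = suc n C suc k
  B = suc n C suc (suc k)
  expand : ∀ k a b → suc (suc k) ℕ.* (a ℕ.+ b) ≡ a ℕ.+ (suc k ℕ.* a ℕ.+ suc (suc k) ℕ.* b)
  expand = ℕ-Solver.solve-∀

-- Degrees of integer-valued functions on ℕⁿ

∂ : ∀ {n} → Fin n → (Vec ℕ n → ℤ) → Vec ℕ n → ℤ
∂ i f v = f (updateAt v i suc) - f v

-- Polynomials of total degree below d are annihilated by every d-fold
-- unit difference; only this consequence of the degree bound is used.
data Deg< {n} : ℕ → (Vec ℕ n → ℤ) → Set where
  null : ∀ {f}   → (∀ v → f v ≡ 0ℤ)       → Deg< zero f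
  step : ∀ {d f} → (∀ i → Deg< d (∂ i f)) → Deg< (suc d) f

Deg<-cong : ∀ {n d} {f g : Vec ℕ n → ℤ} → (∀ v → f v ≡ g v) → Deg< d f → Deg< d g
Deg<-cong f≗g (null f≡0) = null λ v → trans (sym (f≗g v)) (f≡0 v)
Deg<-cong f≗g (step ∂f)  = step λ i →
  Deg<-cong (λ v → cong₂ _-_ (f≗g (updateAt v i suc)) (f≗g v)) (∂f i)

Deg<-suc : ∀ {n d} {f : Vec ℕ n → ℤ} → Deg< d f → Deg< (suc d) f
Deg<-suc (null f≡0) = step λ i → null λ v → cong₂ _-_ (f≡0 (updateAt v i suc)) (f≡0 v)
Deg<-suc (step ∂f)  = step λ i → Deg<-suc (∂f i)

Deg<-mono : ∀ {n d e} {f : Vec ℕ n → ℤ} → d ≤ e → Deg< d f → Deg< e f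
Deg<-mono d≤e = go (ℕ.≤⇒≤′ d≤e)
  where
  go : ∀ {n d e} {f : Vec ℕ n → ℤ} → d ℕ.≤′ e → Deg< d f → Deg< e f
  go ℕ.≤′-refl       deg-f = deg-f
  go (ℕ.≤′-step d≤e) deg-f = Deg<-suc (go d≤e deg-f)

Deg<-null : ∀ {n d} {f : Vec ℕ n → ℤ} → (∀ v → f v ≡ 0ℤ) → Deg< d f
Deg<-null f≡0 = Deg<-mono z≤n (null f≡0)

Deg<-const : ∀ {n} c → Deg< {n} 1 (λ _ → c)
Deg<-const c = step λ i → null λ v → ℤ.+-inverseʳ c

Deg<-+ : ∀ {n d} {f g : Vec ℕ n → ℤ} → Deg< d f → Deg< d g → Deg< d (λ v → f v + g v)
Deg<-+                 (null f≡0) (null g≡0) = null λ v → cong₂ _+_ (f≡0 v) (g≡0 v)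
Deg<-+ {f = f} {g = g} (step ∂f)  (step ∂g)  = step λ i →
  Deg<-cong (λ v → regroup (f (updateAt v i suc)) (f v) (g (updateAt v i suc)) (g v))
    (Deg<-+ (∂f i) (∂g i))
  where
  regroup : ∀ a b c e → (a - b) + (c - e) ≡ (a + c) - (b + e)
  regroup = ℤ-Solver.solve-∀

-- The bounds are strict: degrees at most `a - 1` and `b - 1` give a product of degree at most
-- `a + b - 2`, hence the `pred`. The induction follows the discrete Leibniz rule, which has the
-- extra term `∂ i f v * ∂ i g v`.
Deg<-* : ∀ {n a b} {f g : Vec ℕ n → ℤ} →
  Deg< a f → Deg< b g → Deg< (pred (a ℕ.+ b)) (λ v → f v * g v)
Deg<-* {g = g} (null f≡0) deg-g = Deg<-null λ v → cong (_* g v) (f≡0 v)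
Deg<-* {f = f} (step ∂f) (null g≡0) =
  Deg<-null λ v → trans (cong (f v *_) (g≡0 v)) (ℤ.*-zeroʳ (f v))
Deg<-* {a = suc a} {b = suc b} {f} {g} deg-f@(step ∂f) deg-g@(step ∂g) =
  subst (λ d → Deg< d (λ v → f v * g v)) (sym (ℕ.+-suc a b)) (step λ i →
    Deg<-cong (λ v → leibniz (f (updateAt v i suc)) (f v) (g (updateAt v i suc)) (g v))
      (Deg<-+
        (Deg<-+
          (subst (λ d → Deg< d (λ v → ∂ i f v * g v)) (cong pred (ℕ.+-suc a b))
            (Deg<-* (∂f i) deg-g))
          (Deg<-* deg-f (∂g i)))
        -- Both factors have been differenced here, so the bound is one better than required and is
        -- relaxed.
        (Deg<-mono (ℕ.pred[n]≤n {a ℕ.+ b}) (Deg<-* (∂f i) (∂g i)))))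
  where
  leibniz : ∀ x′ x y′ y → ((x′ - x) * y + x * (y′ - y)) + (x′ - x) * (y′ - y) ≡ x′ * y′ - x * y
  leibniz = ℤ-Solver.solve-∀

Deg<-^ : ∀ {n d} k {f : Vec ℕ n → ℤ} → Deg< (suc d) f → Deg< (suc (k ℕ.* d)) (λ v → f v ^ k)
Deg<-^         zero        deg-f = Deg<-const 1ℤ
Deg<-^ {d = d} (suc k) {f} deg-f =
  subst (λ e → Deg< e (λ v → f v ^ suc k)) (ℕ.+-suc d (k ℕ.* d)) (Deg<-* deg-f (Deg<-^ k deg-f))

Deg<-1- : ∀ {n d} {f : Vec ℕ n → ℤ} → Deg< (suc d) f → Deg< (suc d) (λ v → 1ℤ - f v)
Deg<-1- {f = f} deg-f = Deg<-cong (λ v → cong (_+_ 1ℤ) (ℤ.-1*i≡-i (f v)))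
  (Deg<-+ (Deg<-mono (s≤s z≤n) (Deg<-const 1ℤ)) (Deg<-* (Deg<-const (- 1ℤ)) deg-f))

Deg<-tail : ∀ {n d} {f : Vec ℕ n → ℤ} → Deg< d f → Deg< d (f ∘ tail)
Deg<-tail         (null f≡0) = null λ { (x ∷ v) → f≡0 v }
Deg<-tail {f = f} (step ∂f)  = step λ
  { zero    → Deg<-null λ { (x ∷ v) → ℤ.+-inverseʳ (f v) }
  ; (suc i) → Deg<-cong (λ { (x ∷ v) → refl }) (Deg<-tail (∂f i))
  }

Deg<-∷ : ∀ {n d} a {f : Vec ℕ (suc n) → ℤ} → Deg< d f → Deg< d (λ v → f (a ∷ v))
Deg<-∷ a (null f≡0) = null λ v → f≡0 (a ∷ v)
Deg<-∷ a (step ∂f)  = step λ i → Deg<-∷ a (∂f (suc i))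

Deg<-head : ∀ {n} → Deg< {suc n} 2 (λ v → + head v)
Deg<-head = step λ
  { zero    → Deg<-cong (λ { (x ∷ v) → difference (+ x) }) (Deg<-const 1ℤ)
  ; (suc i) → Deg<-null λ { (x ∷ v) → ℤ.+-inverseʳ (+ x) }
  }
  where
  difference : ∀ a → 1ℤ ≡ (1ℤ + a) - a
  difference = ℤ-Solver.solve-∀

quad : ∀ {n} → Vec ℕ n → Vec ℕ n → ℕ
quad []       []       = 0
quad (u ∷ us) (c ∷ cs) = u ℕ.* u ℕ.* c ℕ.+ quad us cs

quad-zero : ∀ {n} (cs : Vec ℕ n) → quad (replicate n 0) cs ≡ 0
quad-zero []       = refl
quad-zero (c ∷ cs) = quad-zero cs

Deg<-quad : ∀ {n} (cs : Vec ℕ n) → Deg< 3 (λ v → + quad v cs)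
-- Without variables there is no direction to difference in, so the condition is vacuous.
Deg<-quad []       = step λ ()
Deg<-quad (c ∷ cs) = Deg<-cong split
  (Deg<-+ (Deg<-* (Deg<-* Deg<-head Deg<-head) (Deg<-const (+ c)))
    (Deg<-tail (Deg<-quad cs)))
  where
  split : ∀ v → + head v * + head v * + c + + quad (tail v) cs ≡ + quad v (c ∷ cs)
  split (u ∷ us) = begin
    + u * + u * + c + + quad us cs       ≡⟨ cong (λ x → x * + c + + quad us cs) (ℤ.pos-* u u) ⟨
    + (u ℕ.* u) * + c + + quad us cs     ≡⟨ cong (_+ + quad us cs) (ℤ.pos-* (u ℕ.* u) c) ⟨
    + (u ℕ.* u ℕ.* c) + + quad us cs     ≡⟨ ℤ.pos-+ (u ℕ.* u ℕ.* c) (quad us cs) ⟨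
    + (u ℕ.* u ℕ.* c ℕ.+ quad us cs)     ∎

-- Sums over the box {0, …, m-1}ⁿ

∑□ : ∀ n → ℕ → (Vec ℕ n → ℤ) → ℤ
∑□ zero    m f = f []
∑□ (suc n) m f = ∑ (λ a → ∑□ n m (λ v → f (a ∷ v))) m

∑□-minus : ∀ n m f g → ∑□ n m f - ∑□ n m g ≡ ∑□ n m (λ v → f v - g v)
∑□-minus zero    m f g = refl
∑□-minus (suc n) m f g = trans (∑-minus _ _ m)
  (∑-cong (λ a → ∑□-minus n m (λ v → f (a ∷ v)) (λ v → g (a ∷ v))) m)

∂₀^ : ∀ {n} → ℕ → (Vec ℕ (suc n) → ℤ) → Vec ℕ (suc n) → ℤ
∂₀^ zero    f = f
∂₀^ (suc k) f = ∂₀^ k (∂ zero f)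

Deg<-∂₀^ : ∀ {n} k d {f : Vec ℕ (suc n) → ℤ} → Deg< (k ℕ.+ d) f → Deg< d (∂₀^ k f)
Deg<-∂₀^ zero    d deg-f     = deg-f
Deg<-∂₀^ (suc k) d (step ∂f) = Deg<-∂₀^ k d (∂f zero)

-- Differencing in the first variable commutes with summing out the others, so the one-variable
-- congruence for sums applies to a box sum.
Δ^-∑□ : ∀ n m k f a →
  Δ^ k (λ b → ∑□ n m (λ v → f (b ∷ v))) a ≡ ∑□ n m (λ v → ∂₀^ k f (a ∷ v))
Δ^-∑□ n m zero    f a = refl
Δ^-∑□ n m (suc k) f a = trans
  (Δ^-cong k (λ b → ∑□-minus n m (λ v → f (suc b ∷ v)) (λ v → f (b ∷ v))) a)
  (Δ^-∑□ n m k (∂ zero f) a)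

∑□-∣ : ∀ {d} n m f → (∀ v → All (_< m) v → d ∣ℤ f v) → d ∣ℤ ∑□ n m f
∑□-∣ zero    m f d∣f = d∣f [] []
∑□-∣ (suc n) m f d∣f = ∑-∣ m λ a a<m → ∑□-∣ n m _ λ v v<m → d∣f (a ∷ v) (a<m ∷ v<m)

-- Finite search for common zeros

anyVec? : ∀ {m} n {P : Vec (Fin m) n → Set} → (∀ v → Dec (P v)) → Dec (∃ P)
anyVec? zero    P? = map′ ([] ,_) (λ { ([] , Pv) → Pv }) (P? [])
anyVec? (suc n) P? = map′ (λ { (a , v , Pv) → a ∷ v , Pv }) (λ { (a ∷ v , Pv) → a , v , Pv })
  (any? λ a → anyVec? n λ v → P? (a ∷ v))

map-toℕ-surjective : ∀ {m n} {v : Vec ℕ n} → All (_< m) v → ∃ λ (w : Vec (Fin m) n) → map toℕ w ≡ v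
map-toℕ-surjective []            = [] , refl
map-toℕ-surjective (a<m ∷ v<m) with w , eq ← map-toℕ-surjective v<m =
  fromℕ< a<m ∷ w , cong₂ _∷_ (toℕ-fromℕ< a<m) eq

CommonZero : ∀ p {n} (cs ds : Vec ℕ n) → Vec (Fin p) n → Set
CommonZero p cs ds w =
  Any (λ u → p ∤ toℕ u) w × p ∣ quad (map toℕ w) cs × p ∣ quad (map toℕ w) ds

commonZero? : ∀ {p n} (cs ds : Vec ℕ n) w → Dec (CommonZero p cs ds w)
commonZero? {p} cs ds w =
  VecAny.any? (λ u → ¬? (p ∣? toℕ u)) w ×-dec
  p ∣? quad (map toℕ w) cs ×-dec p ∣? quad (map toℕ w) ds

-- Fermat's little theorem and Chevalley's theorem

module ModPrime (q : ℕ) (p-prime : Prime (suc q)) where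

  p = suc q

  -- By absorption `p` divides `suc k ℕ.* (p C suc k)`, and it cannot divide `suc k`, which lies
  -- strictly between `0` and `p`.
  p∣pC[1+k] : ∀ k → k < q → p ∣ p C suc k
  p∣pC[1+k] k k<q
    with euclidsLemma (suc k) (p C suc k) p-prime
           (subst (p ∣_) (sym ([1+k]*[1+n]C[1+k]≡[1+n]*nCk q k)) (m∣m*n (q C k)))
  ... | inj₁ p∣1+k = contradiction p∣1+k (>⇒∤ (s≤s k<q))
  ... | inj₂ p∣pCk = p∣pCk

  -- In Newton's formula at `p` every coefficient except the first and the last is divisible by `p`.
  f[p]≈f[0]+Δ^pf[0] : ∀ f → + p ∣ℤ f p - (f 0 + Δ^ p f 0)
  f[p]≈f[0]+Δ^pf[0] f = subst (+ p ∣ℤ_) (sym f[p]-ends≡middle)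
    (∑-∣ q λ k k<q → ℤ∣.∣m⇒∣m*n {m = + (p C suc k)} (Δ^ (suc k) f 0) (ℤ∣.∣ᵤ⇒∣ (p∣pC[1+k] k k<q)))
    where
    T : ℕ → ℤ
    T k = + (p C k) * Δ^ k f 0
    ends : ∀ a b m → ((1ℤ * a + m) + 1ℤ * b) - (a + b) ≡ m
    ends = ℤ-Solver.solve-∀
    f[p]-ends≡middle : f p - (f 0 + Δ^ p f 0) ≡ ∑ (T ∘ suc) q
    f[p]-ends≡middle = begin
      f p - (f 0 + Δ^ p f 0)
        ≡⟨ cong (_- (f 0 + Δ^ p f 0)) (newton p f) ⟩
      (∑ T p + T p) - (f 0 + Δ^ p f 0)
        ≡⟨ cong₂ (λ s c → (s + + c * Δ^ p f 0) - (f 0 + Δ^ p f 0)) (∑-head T q) (nCn≡1 p) ⟩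
      ((1ℤ * f 0 + ∑ (T ∘ suc) q) + 1ℤ * Δ^ p f 0) - (f 0 + Δ^ p f 0)
        ≡⟨ ends (f 0) (Δ^ p f 0) (∑ (T ∘ suc) q) ⟩
      ∑ (T ∘ suc) q ∎

  -- The preceding congruence applied to the partial sums `∑ f`, which start at `0` and have first
  -- difference `f`.
  ∑f≈Δ^qf[0] : ∀ f → + p ∣ℤ ∑ f p - Δ^ q f 0
  ∑f≈Δ^qf[0] f = subst (+ p ∣ℤ_)
    (cong (_-_ (∑ f p)) (trans (ℤ.+-identityˡ (Δ^ p (∑ f) 0)) (Δ^-cong q (λ n → telescope (∑ f n) (f n)) 0)))
    (f[p]≈f[0]+Δ^pf[0] (∑ f))
    where
    telescope : ∀ s a → (s + a) - s ≡ a
    telescope = ℤ-Solver.solve-∀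

  Δ^-^ : ∀ k a j → Δ^ k ((1ℤ + a) ^_) j ≡ a ^ k * (1ℤ + a) ^ j
  Δ^-^ zero    a j = sym (ℤ.*-identityˡ _)
  Δ^-^ (suc k) a j = begin
    Δ^ (suc k) ((1ℤ + a) ^_) j
      ≡⟨ Δ^-suc k ((1ℤ + a) ^_) j ⟩
    Δ^ k ((1ℤ + a) ^_) (suc j) - Δ^ k ((1ℤ + a) ^_) j
      ≡⟨ cong₂ _-_ (Δ^-^ k a (suc j)) (Δ^-^ k a j) ⟩
    a ^ k * ((1ℤ + a) * (1ℤ + a) ^ j) - a ^ k * (1ℤ + a) ^ j
      ≡⟨ factor a (a ^ k) ((1ℤ + a) ^ j) ⟩
    a * a ^ k * (1ℤ + a) ^ j ∎
    where
    factor : ∀ a x y → x * ((1ℤ + a) * y) - x * y ≡ a * x * y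
    factor = ℤ-Solver.solve-∀

  -- Induction on `n`: for the powers of `1 + n` the `p`-th difference at `0` is `n ^ p`, so the
  -- congruence at `p` reads `(1 + n) ^ p ≈ 1 + n ^ p`.
  n^p≈n : ∀ n → + p ∣ℤ (+ n) ^ p - + n
  n^p≈n zero    = ℤ∣.divides 0ℤ refl
  n^p≈n (suc n) = subst (+ p ∣ℤ_) combine
    (ℤ∣.∣m∣n⇒∣m+n (f[p]≈f[0]+Δ^pf[0] ((1ℤ + + n) ^_)) (n^p≈n n))
    where
    add : ∀ x y z → (x - (1ℤ + y * 1ℤ)) + (y - z) ≡ x - (1ℤ + z)
    add = ℤ-Solver.solve-∀
    combine : (1ℤ + + n) ^ p - (1ℤ + Δ^ p ((1ℤ + + n) ^_) 0) + ((+ n) ^ p - + n) ≡ (+ suc n) ^ p - + suc n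
    combine = trans
      (cong (λ d → (1ℤ + + n) ^ p - (1ℤ + d) + ((+ n) ^ p - + n)) (Δ^-^ p (+ n) 0))
      (add ((1ℤ + + n) ^ p) ((+ n) ^ p) (+ n))

  euclidℤ : ∀ a b → + p ∣ℤ a * b → (+ p ∣ℤ a) ⊎ (+ p ∣ℤ b)
  euclidℤ a b p∣ab
    with euclidsLemma _ _ p-prime (subst (p ∣_) (ℤ.abs-* a b) (ℤ∣.∣⇒∣ᵤ p∣ab))
  ... | inj₁ p∣a = inj₁ (ℤ∣.∣ᵤ⇒∣ p∣a)
  ... | inj₂ p∣b = inj₂ (ℤ∣.∣ᵤ⇒∣ p∣b)

  fermat : ∀ n → p ∤ n → + p ∣ℤ 1ℤ - (+ n) ^ q
  fermat n p∤n = [ (λ p∣n → contradiction (ℤ∣.∣⇒∣ᵤ p∣n) p∤n) , (λ p∣1-n^q → p∣1-n^q) ]′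
    (euclidℤ (+ n) (1ℤ - (+ n) ^ q) p∣n[1-n^q])
    where
    factor : ∀ a x → - (a * x - a) ≡ a * (1ℤ - x)
    factor = ℤ-Solver.solve-∀
    p∣n[1-n^q] : + p ∣ℤ + n * (1ℤ - (+ n) ^ q)
    p∣n[1-n^q] = subst (+ p ∣ℤ_) (factor (+ n) ((+ n) ^ q)) (ℤ∣.∣m⇒∣-m (n^p≈n n))

  -- Summing over the first variable amounts modulo `p` to a `q`-fold difference, which leaves a
  -- function of degree below `n ℕ.* q` in the other `n` variables. With no variables left the bound
  -- is `0`, which forces the value to vanish.
  ∑□≈0 : ∀ n {f : Vec ℕ n → ℤ} → Deg< (n ℕ.* q) f → + p ∣ℤ ∑□ n p f
  ∑□≈0 zero        (null f≡0) = subst (+ p ∣ℤ_) (sym (f≡0 [])) (ℤ∣.divides 0ℤ refl)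
  ∑□≈0 (suc n) {f} deg-f      = ∣-resp-difference (∑f≈Δ^qf[0] (λ a → ∑□ n p (λ v → f (a ∷ v))))
    (subst (+ p ∣ℤ_) (sym (Δ^-∑□ n p q f 0))
      (∑□≈0 n (Deg<-∷ 0 (Deg<-∂₀^ q (n ℕ.* q) deg-f))))

  -- The origin is the only point of the box with all coordinates divisible by `p`, so every other
  -- summand vanishes modulo `p`.
  ∑□≈f[0] : ∀ n f → (∀ v → All (_< p) v → Any (p ∤_) v → + p ∣ℤ f v) →
    + p ∣ℤ ∑□ n p f - f (replicate n 0)
  ∑□≈f[0] zero    f p∣f = ℤ∣.divides 0ℤ (ℤ.+-inverseʳ (f []))
  ∑□≈f[0] (suc n) f p∣f = subst (+ p ∣ℤ_) split (ℤ∣.∣m∣n⇒∣m+n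
    (∑□≈f[0] n (λ v → f (0 ∷ v)) λ v v<p p∤v → p∣f (0 ∷ v) (s≤s z≤n ∷ v<p) (there p∤v))
    (∑-∣ q λ a a<q → ∑□-∣ n p _ λ v v<p →
      p∣f (suc a ∷ v) (s≤s a<q ∷ v<p) (here (>⇒∤ (s≤s a<q)))))
    where
    S : ℕ → ℤ
    S a = ∑□ n p (λ v → f (a ∷ v))
    regroup : ∀ s t c → (s - c) + t ≡ (s + t) - c
    regroup = ℤ-Solver.solve-∀
    split : (S 0 - f (replicate (suc n) 0)) + ∑ (S ∘ suc) q ≡ ∑ S p - f (replicate (suc n) 0)
    split = trans (regroup (S 0) (∑ (S ∘ suc) q) (f (replicate (suc n) 0)))
      (cong (_- f (replicate (suc n) 0)) (sym (∑-head S q)))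

  -- By Fermat each `indicator` vanishes modulo `p` where its form does not. Without a nontrivial
  -- common zero the box sum of `F` is therefore congruent to its value `1` at the origin, while its
  -- degree, at most `4q`, makes the sum vanish.
  chevalley : ∀ {n} → 4 < n → (cs ds : Vec ℕ n) → ∃ (CommonZero p cs ds)
  chevalley {n} 4<n cs ds with anyVec? n (commonZero? cs ds)
  ... | yes zero-found = zero-found
  ... | no  no-zero    = contradiction p∣1 (>⇒∤ 1<p)
    where
    indicator : Vec ℕ n → Vec ℕ n → ℤ
    indicator es v = 1ℤ - (+ quad v es) ^ q
    F : Vec ℕ n → ℤ
    F v = indicator cs v * indicator ds v
    1<p : 1 < p
    1<p = ℕ.nonTrivial⇒n>1 p {{prime⇒nonTrivial p-prime}}
    deg-indicator : ∀ es → Deg< (suc (q ℕ.* 2)) (indicator es)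
    deg-indicator es = Deg<-1- (Deg<-^ q (Deg<-quad es))
    -- The strict bound is `1 + 4q`; it is at most `5q` because `1 ≤ q`, and `5 ≤ n`.
    4q<nq : pred (suc (q ℕ.* 2) ℕ.+ suc (q ℕ.* 2)) ≤ n ℕ.* q
    4q<nq = ℕ.≤-trans (ℕ.≤-reflexive (double q))
      (ℕ.≤-trans (ℕ.+-monoˡ-≤ (4 ℕ.* q) (ℕ.≤-pred 1<p)) (ℕ.*-monoˡ-≤ q 4<n))
      where
      double : ∀ q → q ℕ.* 2 ℕ.+ suc (q ℕ.* 2) ≡ 1 ℕ.+ 4 ℕ.* q
      double = ℕ-Solver.solve-∀
    deg-F : Deg< (n ℕ.* q) F
    deg-F = Deg<-mono 4q<nq (Deg<-* (deg-indicator cs) (deg-indicator ds))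
    F≈0 : ∀ v → All (_< p) v → Any (p ∤_) v → + p ∣ℤ F v
    F≈0 v v<p p∤v with w , refl ← map-toℕ-surjective v<p
      with p ∣? quad v cs | p ∣? quad v ds
    ... | no p∤cs | _       = ℤ∣.∣m⇒∣m*n {m = indicator cs v} (indicator ds v) (fermat (quad v cs) p∤cs)
    ... | yes _   | no p∤ds = ℤ∣.∣n⇒∣m*n (indicator cs v) {indicator ds v} (fermat (quad v ds) p∤ds)
    ... | yes p∣cs | yes p∣ds = contradiction (w , VecAny.map⁻ p∤v , p∣cs , p∣ds) no-zero
    indicator[0]≡1 : ∀ es → indicator es (replicate n 0) ≡ 1ℤ
    indicator[0]≡1 es = trans (cong (λ x → 1ℤ - (+ x) ^ q) (quad-zero es))
      (cong (_-_ 1ℤ) (0^ (ℕ.≤-pred 1<p)))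
      where
      -- Positivity matters, since `0ℤ ^ 0` is `1ℤ`.
      0^ : ∀ {k} → 0 < k → 0ℤ ^ k ≡ 0ℤ
      0^ (s≤s _) = refl
    p∣1 : p ∣ 1
    p∣1 = ℤ∣.∣⇒∣ᵤ (subst (+ p ∣ℤ_)
      (trans (cancel (∑□ n p F) (F (replicate n 0))) (cong₂ _*_ (indicator[0]≡1 cs) (indicator[0]≡1 ds)))
      (ℤ∣.∣m∣n⇒∣m-n (∑□≈0 n deg-F) (∑□≈f[0] n F F≈0)))
      where
      cancel : ∀ s a → s - (s - a) ≡ a
      cancel = ℤ-Solver.solve-∀

fermat : ∀ {p} → Prime p → ∀ n → p ∤ n → + p ∣ℤ 1ℤ - (+ n) ^ pred p
fermat {zero}  p-prime = contradiction p-prime ¬prime[0]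
fermat {suc q} p-prime = ModPrime.fermat q p-prime

chevalley : ∀ {p} → Prime p → ∀ {n} → 4 < n → (cs ds : Vec ℕ n) → ∃ (CommonZero p cs ds)
chevalley {zero}  p-prime = contradiction p-prime ¬prime[0]
chevalley {suc q} p-prime = ModPrime.chevalley q p-prime

pos-^ : ∀ a k → + (a ℕ.^ k) ≡ (+ a) ^ k
pos-^ a zero    = refl
pos-^ a (suc k) = trans (ℤ.pos-* a (a ℕ.^ k)) (cong (+ a *_) (pos-^ a k))

suc-pred-pred : ∀ {p} → 2 < p → suc (pred (pred p)) ≡ pred p
suc-pred-pred (s≤s (s≤s _)) = refl

-- With `p = r + 3` this is the identity `(r + 2)² = (r + 1)(r + 3) + 1`.
-1²≡1² : ∀ {p} → 2 < p → ∀ g → p ∣ pred p ℕ.* pred p ℕ.+ g → p ∣ 1 ℕ.* 1 ℕ.+ g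
-1²≡1² {suc (suc (suc r))} (s≤s (s≤s (s≤s z≤n))) g p∣q²+g =
  ∣m+n∣m⇒∣n (subst (3 ℕ.+ r ∣_) (expand r g) p∣q²+g) (n∣m*n (1 ℕ.+ r))
  where
  expand : ∀ r g → (2 ℕ.+ r) ℕ.* (2 ℕ.+ r) ℕ.+ g ≡ (1 ℕ.+ r) ℕ.* (3 ℕ.+ r) ℕ.+ (1 ℕ.+ g)
  expand = ℕ-Solver.solve-∀

module OddPrime (p : ℕ) (p-prime : Prime p) (2<p : 2 < p) where

  private instance
    p-nonZero : NonZero p
    p-nonZero = prime⇒nonZero p-prime

  open ModP p {{prime⇒nonZero p-prime}}
    using (ℤₚ; 0ₚ; 1ₚ; sum; U; Q; HasZeroSumSubsequence; AllHaveZeroSumSubsequence; D_≔_)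
    renaming (_+_ to _+ₚ_; _*_ to _*ₚ_)

  -- Residues modulo an odd prime

  φ : ℕ → ℤₚ
  φ n = n mod p

  toℕ-φ : ∀ n → toℕ (φ n) ≡ n % p
  toℕ-φ n = toℕ-fromℕ< _

  φ-≡ : ∀ {m n} → m % p ≡ n % p → φ m ≡ φ n
  φ-≡ {m} {n} eq = toℕ-injective (trans (toℕ-φ m) (trans eq (sym (toℕ-φ n))))

  φ-toℕ : ∀ x → φ (toℕ x) ≡ x
  φ-toℕ x = toℕ-injective (trans (toℕ-φ (toℕ x)) (m<n⇒m%n≡m (toℕ<n x)))

  φ-+ : ∀ m n → φ m +ₚ φ n ≡ φ (m ℕ.+ n)
  φ-+ m n = φ-≡ (trans (cong (_% p) (cong₂ ℕ._+_ (toℕ-φ m) (toℕ-φ n))) (sym (%-distribˡ-+ m n p)))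

  φ-* : ∀ m n → φ m *ₚ φ n ≡ φ (m ℕ.* n)
  φ-* m n = φ-≡ (trans (cong (_% p) (cong₂ ℕ._*_ (toℕ-φ m) (toℕ-φ n))) (sym (%-distribˡ-* m n p)))

  φ-drop : ∀ {m} n → p ∣ m → φ (m ℕ.+ n) ≡ φ n
  φ-drop n p∣m = φ-≡ (%-remove-+ˡ n p∣m)

  φ≡⇒∣ : ∀ {m n} → φ m ≡ φ n → p ∣ m → p ∣ n
  φ≡⇒∣ {m} {n} eq p∣m = m%n≡0⇒n∣m n p (begin
    n % p      ≡⟨ toℕ-φ n ⟨
    toℕ (φ n)  ≡⟨ cong toℕ eq ⟨
    toℕ (φ m)  ≡⟨ toℕ-φ m ⟩
    m % p      ≡⟨ n∣m⇒m%n≡0 m p p∣m ⟩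
    0          ∎)

  φ≡0⇒∣ : ∀ {n} → φ n ≡ 0ₚ → p ∣ n
  φ≡0⇒∣ eq = φ≡⇒∣ (sym eq) (divides 0 refl)

  ∣⇒φ≡0 : ∀ {n} → p ∣ n → φ n ≡ 0ₚ
  ∣⇒φ≡0 {n} p∣n = φ-≡ {n} {0} (trans (n∣m⇒m%n≡0 n p p∣n) (sym (n∣m⇒m%n≡0 0 p (divides 0 refl))))

  n≤m∧∣-⇒φ≡ : ∀ {m n} → n ≤ m → + p ∣ℤ + m - + n → φ m ≡ φ n
  n≤m∧∣-⇒φ≡ {m} {n} n≤m p∣m-n = trans (cong φ (sym (ℕ.m∸n+n≡m n≤m)))
    (φ-drop n (ℤ∣.∣⇒∣ᵤ (subst (+ p ∣ℤ_) (trans (ℤ.m-n≡m⊖n m n) (ℤ.⊖-≥ n≤m)) p∣m-n)))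

  ∣-⇒φ≡ : ∀ m n → + p ∣ℤ + m - + n → φ m ≡ φ n
  ∣-⇒φ≡ m n p∣m-n with ℕ.≤-total n m
  ... | inj₁ n≤m = n≤m∧∣-⇒φ≡ n≤m p∣m-n
  ... | inj₂ m≤n = sym (n≤m∧∣-⇒φ≡ m≤n (subst (+ p ∣ℤ_) (swap (+ m) (+ n)) (ℤ∣.∣m⇒∣-m p∣m-n)))
    where
    swap : ∀ a b → - (a - b) ≡ b - a
    swap = ℤ-Solver.solve-∀

  ∣m+n∣n⇒∣m : ∀ {m n} → p ∣ m ℕ.+ n → p ∣ n → p ∣ m
  ∣m+n∣n⇒∣m {m} {n} p∣m+n = ∣m+n∣m⇒∣n (subst (p ∣_) (ℕ.+-comm m n) p∣m+n)

  ∣m*m⇒∣m : ∀ m → p ∣ m ℕ.* m → p ∣ m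
  ∣m*m⇒∣m m p∣m*m with euclidsLemma m m p-prime p∣m*m
  ... | inj₁ p∣m = p∣m
  ... | inj₂ p∣m = p∣m

  toℕ-0ₚ : toℕ 0ₚ ≡ 0
  toℕ-0ₚ = trans (toℕ-φ 0) (m<n⇒m%n≡m (ℕ.<-trans ℕ.0<1+n 2<p))

  toℕ-1ₚ : toℕ 1ₚ ≡ 1
  toℕ-1ₚ = trans (toℕ-φ 1) (m<n⇒m%n≡m (ℕ.<-trans ℕ.≤-refl 2<p))

  inverse : ∀ {u} → p ∤ u → ∃ λ w → φ (u ℕ.* w) ≡ 1ₚ
  -- By Fermat `u` to the power `p - 2` is an inverse of `u`.
  inverse {u} p∤u = u ℕ.^ pred (pred p) , sym (∣-⇒φ≡ 1 (u ℕ.* u ℕ.^ pred (pred p))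
    (subst (λ x → + p ∣ℤ 1ℤ - x) (sym (trans (pos-^ u (suc (pred (pred p))))
                                        (cong ((+ u) ^_) (suc-pred-pred 2<p))))
      (fermat p-prime u p∤u)))

  U⇒∤ : ∀ {u} → U u → p ∤ toℕ u
  U⇒∤ (w , uw≡1) p∣u =
    contradiction (φ≡⇒∣ uw≡1 (∣m⇒∣m*n (toℕ w) p∣u)) (>⇒∤ (ℕ.<-trans ℕ.≤-refl 2<p))

  ∤⇒U : ∀ {u} → p ∤ toℕ u → U u
  ∤⇒U {u} p∤u with w , uw≡1 ← inverse p∤u =
    φ w , trans (cong (_*ₚ φ w) (sym (φ-toℕ u))) (trans (φ-* (toℕ u) w) uw≡1)

  -- Weighted zero-sums as common zeros of diagonal quadratic forms

  ⟦_⟧ : ∀ {k} → Vec ℤₚ k → Vec ℕ k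
  ⟦_⟧ = map toℕ

  -- A weight in Q is the square of a unit, and a term left out of the
  -- subsequence gets the weight 0 = 0².
  Solution : Subset p → ∀ {k} → Vec ℤₚ k → Set
  Solution B xs = ∃₂ λ us bs → All (_∈ B) bs × CommonZero p ⟦ xs ⟧ ⟦ bs ⟧ us

  φ-drop-square : ∀ u x n → p ∣ u → φ (u ℕ.* u ℕ.* x ℕ.+ n) ≡ φ n
  φ-drop-square u x n p∣u = φ-drop n (∣m⇒∣m*n x (∣m⇒∣m*n u p∣u))

  square-*ₚ : ∀ u x → (u *ₚ u) *ₚ x ≡ φ (toℕ u ℕ.* toℕ u ℕ.* toℕ x)
  square-*ₚ u x = trans (cong ((u *ₚ u) *ₚ_) (sym (φ-toℕ x))) (φ-* (toℕ u ℕ.* toℕ u) (toℕ x))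

  *ₚ-square : ∀ b u → b *ₚ (u *ₚ u) ≡ φ (toℕ u ℕ.* toℕ u ℕ.* toℕ b)
  *ₚ-square b u = trans (cong φ (ℕ.*-comm (toℕ b) (toℕ (u *ₚ u)))) (square-*ₚ u b)

  sum-∷ : ∀ {x s} m n → x ≡ φ m → s ≡ φ n → x +ₚ s ≡ φ (m ℕ.+ n)
  sum-∷ m n x≡ s≡ = trans (cong₂ _+ₚ_ x≡ s≡) (φ-+ m n)

  -- Terms whose root is divisible by `p` contribute nothing modulo `p` and are dropped; the squares
  -- of the remaining roots are the weights. A root not divisible by `p` keeps the subsequence
  -- non-empty.
  restrict : ∀ {B k} (us xs bs : Vec ℤₚ k) → All (_∈ B) bs →
    ∃ λ m → ∃ λ (ys : Vec ℤₚ m) → ∃₂ λ as cs →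
      toList ys ⊆ toList xs × All Q as × All (_∈ B) cs ×
      sum (zipWith _*ₚ_ as ys) ≡ φ (quad ⟦ us ⟧ ⟦ xs ⟧) ×
      sum (zipWith _*ₚ_ cs as) ≡ φ (quad ⟦ us ⟧ ⟦ bs ⟧) ×
      (Any (λ u → p ∤ toℕ u) us → 1 ≤ m)
  restrict []       []       []       []             =
    0 , [] , [] , [] , [] , [] , [] , refl , refl , λ ()
  restrict (u ∷ us) (x ∷ xs) (b ∷ bs) (b∈B ∷ bs∈B)
    with m , ys , as , cs , ys⊆xs , as∈Q , cs∈B , Σay≡ , Σca≡ , 1≤m ← restrict us xs bs bs∈B
    with p ∣? toℕ u
  ... | yes p∣u =
    m , ys , as , cs , x ∷ʳ ys⊆xs , as∈Q , cs∈B ,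
    trans Σay≡ (sym (φ-drop-square (toℕ u) (toℕ x) _ p∣u)) ,
    trans Σca≡ (sym (φ-drop-square (toℕ u) (toℕ b) _ p∣u)) ,
    λ { (here p∤u) → contradiction p∣u p∤u ; (there p∤us) → 1≤m p∤us }
  ... | no p∤u =
    suc m , x ∷ ys , (u *ₚ u) ∷ as , b ∷ cs ,
    refl ∷ ys⊆xs , (u , ∤⇒U p∤u , refl) ∷ as∈Q , b∈B ∷ cs∈B ,
    sum-∷ (toℕ u ℕ.* toℕ u ℕ.* toℕ x) _ (square-*ₚ u x) Σay≡ ,
    sum-∷ (toℕ u ℕ.* toℕ u ℕ.* toℕ b) _ (*ₚ-square b u) Σca≡ ,
    λ _ → s≤s z≤n

  -- The converse of `restrict`: each term of the subsequence gets a square root of its weight.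
  extend : ∀ {B b m k} → b ∈ B → (ys : Vec ℤₚ m) (xs : Vec ℤₚ k) → toList ys ⊆ toList xs →
    (as cs : Vec ℤₚ m) → All Q as → All (_∈ B) cs →
    ∃₂ λ us bs → All (_∈ B) bs ×
      φ (quad ⟦ us ⟧ ⟦ xs ⟧) ≡ sum (zipWith _*ₚ_ as ys) ×
      φ (quad ⟦ us ⟧ ⟦ bs ⟧) ≡ sum (zipWith _*ₚ_ cs as) ×
      (1 ≤ m → Any (λ u → p ∤ toℕ u) us)
  extend b∈B []       []       []              []       []       []           []           =
    [] , [] , [] , refl , refl , λ ()
  extend {b = b} b∈B ys (x ∷ xs) (.x ∷ʳ ys⊆xs) as       cs       as∈Q         cs∈B
    with us , bs , bs∈B , ≡Σay , ≡Σca , p∤us ← extend b∈B ys xs ys⊆xs as cs as∈Q cs∈B =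
    -- A skipped term has root `0ₚ`, so any element of `B` can serve as its second weight.
    0ₚ ∷ us , b ∷ bs , b∈B ∷ bs∈B ,
    trans (φ-drop-square (toℕ 0ₚ) (toℕ x) _ p∣0ₚ) ≡Σay ,
    trans (φ-drop-square (toℕ 0ₚ) (toℕ b) _ p∣0ₚ) ≡Σca ,
    there ∘ p∤us
    where
    p∣0ₚ : p ∣ toℕ 0ₚ
    p∣0ₚ = φ≡0⇒∣ (φ-toℕ 0ₚ)
  extend b∈B (y ∷ ys) (.y ∷ xs) (refl ∷ ys⊆xs) (_ ∷ as) (c ∷ cs) ((u , unit , refl) ∷ as∈Q) (c∈B ∷ cs∈B)
    with us , bs , bs∈B , ≡Σay , ≡Σca , _ ← extend b∈B ys xs ys⊆xs as cs as∈Q cs∈B =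
    u ∷ us , c ∷ bs , c∈B ∷ bs∈B ,
    sym (sum-∷ (toℕ u ℕ.* toℕ u ℕ.* toℕ y) _ (square-*ₚ u y) (sym ≡Σay)) ,
    sym (sum-∷ (toℕ u ℕ.* toℕ u ℕ.* toℕ c) _ (*ₚ-square c u) (sym ≡Σca)) ,
    λ _ → here (U⇒∤ unit)

  solution⇒zeroSum : ∀ {B k} {xs : Vec ℤₚ k} → Solution B xs → HasZeroSumSubsequence B xs
  solution⇒zeroSum {xs = xs} (us , bs , bs∈B , p∤us , p∣xs , p∣bs)
    with m , ys , as , cs , ys⊆xs , as∈Q , cs∈B , Σay≡ , Σca≡ , 1≤m ← restrict us xs bs bs∈B =
    m , ys , 1≤m p∤us , ys⊆xs , as , cs , as∈Q , cs∈B ,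
    trans Σay≡ (∣⇒φ≡0 p∣xs) , trans Σca≡ (∣⇒φ≡0 p∣bs)

  zeroSum⇒solution : ∀ {B k} {xs : Vec ℤₚ k} → Nonempty B → HasZeroSumSubsequence B xs → Solution B xs
  zeroSum⇒solution {xs = xs} (b , b∈B) (m , ys , 1≤m , ys⊆xs , as , cs , as∈Q , cs∈B , Σay≡0 , Σca≡0)
    with us , bs , bs∈B , ≡Σay , ≡Σca , p∤us ← extend b∈B ys xs ys⊆xs as cs as∈Q cs∈B =
    us , bs , bs∈B , p∤us 1≤m , φ≡0⇒∣ (trans ≡Σay Σay≡0) , φ≡0⇒∣ (trans ≡Σca Σca≡0)

  -- Decidability, monotonicity in the length and the upper bound

  solution? : ∀ B {k} (xs : Vec ℤₚ k) → Dec (Solution B xs)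
  solution? B {k} xs = anyVec? k λ us → anyVec? k λ bs →
    VecAll.all? (_∈? B) bs ×-dec commonZero? ⟦ xs ⟧ ⟦ bs ⟧ us

  -- A subsequence may have any length, but a `Solution` consists of two vectors of fixed length
  -- over `Fin p`, so exhaustive search decides the equivalent form.
  allHave? : ∀ {B} → Nonempty B → ∀ k → Dec (AllHaveZeroSumSubsequence B k)
  allHave? {B} B≢∅ k with anyVec? k (λ xs → ¬? (solution? B xs))
  ... | yes (xs , none) = no λ all → none (zeroSum⇒solution B≢∅ (all xs))
  ... | no  no-bad      = yes λ xs →
    solution⇒zeroSum (decidable-stable (solution? B xs) λ none → no-bad (xs , none))

  truncate-⊆ : ∀ {j k} (j≤k : j ≤ k) (xs : Vec ℤₚ k) → toList (truncate j≤k xs) ⊆ toList xs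
  truncate-⊆ z≤n       xs       = minimum (toList xs)
  truncate-⊆ (s≤s j≤k) (x ∷ xs) = refl ∷ truncate-⊆ j≤k xs

  allHave-mono : ∀ {B j k} → j ≤ k → AllHaveZeroSumSubsequence B j → AllHaveZeroSumSubsequence B k
  allHave-mono j≤k all xs with m , ys , 1≤m , ys⊆ , wzs ← all (truncate j≤k xs) =
    m , ys , 1≤m , ⊆-trans ys⊆ (truncate-⊆ j≤k xs) , wzs

  -- Longer sequences inherit the property by truncation, so failure at length `k` excludes all
  -- smaller lengths as well.
  D≔suc : ∀ {B k} → AllHaveZeroSumSubsequence B (suc k) → ¬ AllHaveZeroSumSubsequence B k → D B ≔ suc k
  D≔suc all ¬all = s≤s z≤n , all , λ j _ all-j → ℕ.≰⇒> λ j≤k → ¬all (allHave-mono j≤k all-j)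

  allHave-5 : ∀ {B} → Nonempty B → AllHaveZeroSumSubsequence B 5
  allHave-5 (b , b∈B) xs with us , zero-us ← chevalley p-prime ℕ.≤-refl ⟦ xs ⟧ ⟦ replicate 5 b ⟧ =
    solution⇒zeroSum (us , replicate 5 b , b∈B ∷ b∈B ∷ b∈B ∷ b∈B ∷ b∈B ∷ [] , zero-us)

  -- Lower bounds

  φ-*-cong : ∀ {a a′ b b′} → φ a ≡ φ a′ → φ b ≡ φ b′ → φ (a ℕ.* b) ≡ φ (a′ ℕ.* b′)
  φ-*-cong {a} {a′} {b} {b′} a≡ b≡ = trans (sym (φ-* a b)) (trans (cong₂ _*ₚ_ a≡ b≡) (φ-* a′ b′))

  φ-+-cong : ∀ {a a′ b b′} → φ a ≡ φ a′ → φ b ≡ φ b′ → φ (a ℕ.+ b) ≡ φ (a′ ℕ.+ b′)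
  φ-+-cong {a} {a′} {b} {b′} a≡ b≡ = trans (sym (φ-+ a b)) (trans (cong₂ _+ₚ_ a≡ b≡) (φ-+ a′ b′))

  -- 1² = (-1)², so if every -g had a square root then the roots could be
  -- chosen different from -1, which would inject ℤ/p into p - 1 elements.
  nonresidue : ∃ λ (g : ℤₚ) → ∀ (x : ℤₚ) → p ∤ toℕ x ℕ.* toℕ x ℕ.+ toℕ g
  nonresidue with any? {P = λ g → ∀ x → p ∤ toℕ x ℕ.* toℕ x ℕ.+ toℕ g}
                    (λ g → all? λ x → ¬? (p ∣? toℕ x ℕ.* toℕ x ℕ.+ toℕ g))
  ... | yes found = found
  ... | no  none  = contradiction (injective⇒≤ root-injective) (ℕ.<⇒≱ (ℕ.≤-reflexive (ℕ.suc-pred p)))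
    where
    root : ∀ g → ∃ λ x → x < pred p × p ∣ x ℕ.* x ℕ.+ toℕ g
    root g with any? (λ x → p ∣? toℕ x ℕ.* toℕ x ℕ.+ toℕ g)
    ... | no  no-root      = contradiction (g , λ x p∣ → no-root (x , p∣)) none
    ... | yes (x , p∣x²+g) with ℕ.m≤n⇒m<n∨m≡n (ℕ.pred-mono-≤ (toℕ<n x))
    ...   | inj₁ x<q = toℕ x , x<q , p∣x²+g
    ...   | inj₂ x≡q = 1 , ℕ.pred-mono-≤ 2<p ,
      -1²≡1² 2<p (toℕ g) (subst (λ y → p ∣ y ℕ.* y ℕ.+ toℕ g) x≡q p∣x²+g)
    root-unique : ∀ x {g h : ℤₚ} → p ∣ x ℕ.* x ℕ.+ toℕ g → p ∣ x ℕ.* x ℕ.+ toℕ h → g ≡ h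
    root-unique x {g} {h} p∣x²+g p∣x²+h = begin
      g          ≡⟨ φ-toℕ g ⟨
      φ (toℕ g)  ≡⟨ ∣-⇒φ≡ (toℕ g) (toℕ h) (subst (+ p ∣ℤ_)
                      (cancel (+ (x ℕ.* x)) (+ toℕ g) (+ toℕ h))
                      (ℤ∣.∣m∣n⇒∣m-n (ℤ∣.∣ᵤ⇒∣ {+ p} {+ (x ℕ.* x ℕ.+ toℕ g)} p∣x²+g)
                                    (ℤ∣.∣ᵤ⇒∣ {+ p} {+ (x ℕ.* x ℕ.+ toℕ h)} p∣x²+h))) ⟩
      φ (toℕ h)  ≡⟨ φ-toℕ h ⟩
      h          ∎
      where
      cancel : ∀ a b c → (a + b) - (a + c) ≡ b - c
      cancel = ℤ-Solver.solve-∀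
    root′ : ℤₚ → Fin (pred p)
    root′ g = fromℕ< (proj₁ (proj₂ (root g)))
    root-injective : ∀ {g h} → root′ g ≡ root′ h → g ≡ h
    root-injective {g} {h} eq = root-unique (proj₁ (root g)) (proj₂ (proj₂ (root g)))
      (subst (λ x → p ∣ x ℕ.* x ℕ.+ toℕ h) (sym same-root) (proj₂ (proj₂ (root h))))
      where
      same-root : proj₁ (root g) ≡ proj₁ (root h)
      same-root = fromℕ<-injective _ _ (proj₁ (proj₂ (root g))) (proj₁ (proj₂ (root h))) eq

  -- If `v` had an inverse `w`, multiplying by `w` squared would make `u ℕ.* w` a square root of
  -- `-g` modulo `p`.
  nonresidue-anisotropic : ∀ (g : ℤₚ) → (∀ (x : ℤₚ) → p ∤ toℕ x ℕ.* toℕ x ℕ.+ toℕ g) →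
    ∀ u v → p ∣ u ℕ.* u ℕ.+ v ℕ.* v ℕ.* toℕ g → p ∣ v
  nonresidue-anisotropic g no-root u v p∣u²+v²g with p ∣? v
  ... | yes p∣v = p∣v
  ... | no  p∤v with w , vw≡1 ← inverse p∤v =
    contradiction (φ≡⇒∣ scaled (∣n⇒∣m*n (w ℕ.* w) p∣u²+v²g)) (no-root x)
    where
    x = φ (u ℕ.* w)
    distribute : ∀ u v w g → w ℕ.* w ℕ.* (u ℕ.* u ℕ.+ v ℕ.* v ℕ.* g) ≡
      u ℕ.* w ℕ.* (u ℕ.* w) ℕ.+ v ℕ.* w ℕ.* (v ℕ.* w) ℕ.* g
    distribute = ℕ-Solver.solve-∀
    scaled : φ (w ℕ.* w ℕ.* (u ℕ.* u ℕ.+ v ℕ.* v ℕ.* toℕ g)) ≡ φ (toℕ x ℕ.* toℕ x ℕ.+ toℕ g)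
    scaled = begin
      φ (w ℕ.* w ℕ.* (u ℕ.* u ℕ.+ v ℕ.* v ℕ.* toℕ g))
        ≡⟨ cong φ (distribute u v w (toℕ g)) ⟩
      φ (u ℕ.* w ℕ.* (u ℕ.* w) ℕ.+ v ℕ.* w ℕ.* (v ℕ.* w) ℕ.* toℕ g)
        ≡⟨ φ-+-cong (φ-*-cong uw≡x uw≡x) (φ-*-cong {b = toℕ g} (φ-*-cong {a′ = 1} {b′ = 1} vw≡1 vw≡1) refl) ⟩
      φ (toℕ x ℕ.* toℕ x ℕ.+ 1 ℕ.* 1 ℕ.* toℕ g)
        ≡⟨ cong (λ t → φ (toℕ x ℕ.* toℕ x ℕ.+ t)) (ℕ.*-identityˡ (toℕ g)) ⟩
      φ (toℕ x ℕ.* toℕ x ℕ.+ toℕ g) ∎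
      where
      uw≡x : φ (u ℕ.* w) ≡ φ (toℕ x)
      uw≡x = sym (φ-toℕ x)

  -- The first equation is anisotropic in the roots of `1ₚ` and `g` and makes both vanish; the
  -- second then leaves one square times the non-zero weight `b₁`.
  ¬allHave-3 : ∀ {B} → Nonempty B → 0ₚ ∉ B → ¬ AllHaveZeroSumSubsequence B 3
  ¬allHave-3 {B} B≢∅ 0∉B all with g , no-root ← nonresidue =
    no-solution (zeroSum⇒solution B≢∅ (all (0ₚ ∷ 1ₚ ∷ g ∷ [])))
    where
    form : ∀ u₁ u₂ u₃ g → u₁ ℕ.* u₁ ℕ.* 0 ℕ.+ (u₂ ℕ.* u₂ ℕ.* 1 ℕ.+ (u₃ ℕ.* u₃ ℕ.* g ℕ.+ 0)) ≡
      u₂ ℕ.* u₂ ℕ.+ u₃ ℕ.* u₃ ℕ.* g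
    form = ℕ-Solver.solve-∀
    p∤b : ∀ {b} → b ∈ B → p ∤ toℕ b
    p∤b {b} b∈B p∣b = 0∉B (subst (_∈ B) (trans (sym (φ-toℕ b)) (∣⇒φ≡0 p∣b)) b∈B)
    no-solution : ¬ Solution B (0ₚ ∷ 1ₚ ∷ g ∷ [])
    no-solution (u₁ ∷ u₂ ∷ u₃ ∷ [] , b₁ ∷ b₂ ∷ b₃ ∷ [] , b₁∈B ∷ _ , p∤us , p∣xs , p∣bs) =
      trivial p∤us
      where
      x₁ = toℕ u₁
      x₂ = toℕ u₂
      x₃ = toℕ u₃
      p∣x₂²+x₃²g : p ∣ x₂ ℕ.* x₂ ℕ.+ x₃ ℕ.* x₃ ℕ.* toℕ g
      p∣x₂²+x₃²g = subst (p ∣_) (trans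
        (cong₂ (λ z o → x₁ ℕ.* x₁ ℕ.* z ℕ.+ (x₂ ℕ.* x₂ ℕ.* o ℕ.+ (x₃ ℕ.* x₃ ℕ.* toℕ g ℕ.+ 0))) toℕ-0ₚ toℕ-1ₚ)
        (form x₁ x₂ x₃ (toℕ g))) p∣xs
      p∣x₃ : p ∣ x₃
      p∣x₃ = nonresidue-anisotropic g no-root x₂ x₃ p∣x₂²+x₃²g
      p∣x₂ : p ∣ x₂
      p∣x₂ = ∣m*m⇒∣m x₂ (∣m+n∣n⇒∣m p∣x₂²+x₃²g (∣m⇒∣m*n (toℕ g) (∣m⇒∣m*n x₃ p∣x₃)))
      p∣x₁²b₁ : p ∣ x₁ ℕ.* x₁ ℕ.* toℕ b₁
      p∣x₁²b₁ = ∣m+n∣n⇒∣m p∣bs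
        (∣m∣n⇒∣m+n (∣m⇒∣m*n (toℕ b₂) (∣m⇒∣m*n x₂ p∣x₂))
          (∣m∣n⇒∣m+n (∣m⇒∣m*n (toℕ b₃) (∣m⇒∣m*n x₃ p∣x₃)) (divides 0 refl)))
      p∣x₁ : p ∣ x₁
      p∣x₁ with euclidsLemma (x₁ ℕ.* x₁) (toℕ b₁) p-prime p∣x₁²b₁
      ... | inj₁ p∣x₁² = ∣m*m⇒∣m x₁ p∣x₁²
      ... | inj₂ p∣b₁  = contradiction p∣b₁ (p∤b b₁∈B)
      trivial : ¬ Any (λ u → p ∤ toℕ u) (u₁ ∷ u₂ ∷ u₃ ∷ [])
      trivial (here p∤u₁)                 = p∤u₁ p∣x₁
      trivial (there (here p∤u₂))         = p∤u₂ p∣x₂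
      trivial (there (there (here p∤u₃))) = p∤u₃ p∣x₃

  [a*a]^n≡a^[n*2] : ∀ a n → (a * a) ^ n ≡ a ^ (n ℕ.* 2)
  [a*a]^n≡a^[n*2] a zero    = refl
  [a*a]^n≡a^[n*2] a (suc n) = trans (cong (a * a *_) ([a*a]^n≡a^[n*2] a n)) (ℤ.*-assoc a a (a ^ (n ℕ.* 2)))

  -- With `m` odd, the induction step writes `a^(m+2) + b^(m+2)` as
  -- `a²(a^m + b^m) + (a + b)(b - a)b^m`.
  a+b∣a^odd+b^odd : ∀ k a b → a + b ∣ℤ a ^ suc (k ℕ.* 2) + b ^ suc (k ℕ.* 2)
  a+b∣a^odd+b^odd zero    a b = ℤ∣.∣-reflexive (sym (cong₂ _+_ (ℤ.*-identityʳ a) (ℤ.*-identityʳ b)))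
  a+b∣a^odd+b^odd (suc k) a b = subst (a + b ∣ℤ_)
    (expand a b (a ^ suc (k ℕ.* 2)) (b ^ suc (k ℕ.* 2)))
    (ℤ∣.∣m∣n⇒∣m+n
      (ℤ∣.∣n⇒∣m*n (a * a) {a ^ suc (k ℕ.* 2) + b ^ suc (k ℕ.* 2)} (a+b∣a^odd+b^odd k a b))
      (ℤ∣.∣m⇒∣m*n {m = a + b} ((b - a) * b ^ suc (k ℕ.* 2)) ℤ∣.∣-refl))
    where
    expand : ∀ a b x y → a * a * (x + y) + (a + b) * ((b - a) * y) ≡ a * (a * x) + b * (b * y)
    expand = ℤ-Solver.solve-∀

  -- If p = 4k + 3 and a, b are units, then a² + b² divides
  -- a^(p-1) + b^(p-1) ≡ 2, because (p - 1) / 2 is odd.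
  ∣a²+b²⇒∣a : p % 4 ≡ 3 → ∀ a b → p ∣ a ℕ.* a ℕ.+ b ℕ.* b → p ∣ a
  ∣a²+b²⇒∣a p%4≡3 a b p∣a²+b² with p ∣? a
  ... | yes p∣a = p∣a
  ... | no  p∤a = contradiction (ℤ∣.∣⇒∣ᵤ p∣2) (>⇒∤ 2<p)
    where
    k = p ℕ./ 4
    p∤b : p ∤ b
    p∤b p∣b = p∤a (∣m*m⇒∣m a (∣m+n∣n⇒∣m p∣a²+b² (∣m⇒∣m*n b p∣b)))
    p-1≡[1+2k]*2 : pred p ≡ suc (k ℕ.* 2) ℕ.* 2
    p-1≡[1+2k]*2 = cong pred (trans (m≡m%n+[m/n]*n p 4)
      (cong₂ ℕ._+_ p%4≡3 (sym (ℕ.*-assoc k 2 2))))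
    fermat′ : ∀ n → p ∤ n → + p ∣ℤ 1ℤ - (+ n * + n) ^ suc (k ℕ.* 2)
    fermat′ n p∤n = subst (λ x → + p ∣ℤ 1ℤ - x)
      (trans (cong ((+ n) ^_) p-1≡[1+2k]*2) (sym ([a*a]^n≡a^[n*2] (+ n) (suc (k ℕ.* 2)))))
      (fermat p-prime n p∤n)
    p∣A+B : + p ∣ℤ + a * + a + + b * + b
    p∣A+B = subst (+ p ∣ℤ_) (cong₂ _+_ (ℤ.pos-* a a) (ℤ.pos-* b b))
      (ℤ∣.∣ᵤ⇒∣ {+ p} {+ (a ℕ.* a ℕ.+ b ℕ.* b)} p∣a²+b²)
    total : ∀ x y → (1ℤ - x) + (1ℤ - y) + (x + y) ≡ + 2
    total = ℤ-Solver.solve-∀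
    p∣2 : + p ∣ℤ + 2
    p∣2 = subst (+ p ∣ℤ_) (total ((+ a * + a) ^ suc (k ℕ.* 2)) ((+ b * + b) ^ suc (k ℕ.* 2)))
      (ℤ∣.∣m∣n⇒∣m+n (ℤ∣.∣m∣n⇒∣m+n (fermat′ a p∤a) (fermat′ b p∤b))
        (ℤ∣.∣-trans p∣A+B (a+b∣a^odd+b^odd k (+ a * + a) (+ b * + b))))

  -- The first equation is a sum of two squares in `x₃` and `x₄`, so both vanish. As `b₁` and `b₂`
  -- are squares of units, the second becomes a sum of two squares in `x₁` and `x₂` scaled by those
  -- units, so these vanish too.
  ¬allHave-4 : ∀ {B} → p % 4 ≡ 3 → Nonempty B → (∀ {b} → b ∈ B → Q b) → ¬ AllHaveZeroSumSubsequence B 4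
  ¬allHave-4 {B} p%4≡3 B≢∅ B⊆Q all =
    no-solution (zeroSum⇒solution B≢∅ (all (0ₚ ∷ 0ₚ ∷ 1ₚ ∷ 1ₚ ∷ [])))
    where
    form : ∀ u₁ u₂ u₃ u₄ →
      u₁ ℕ.* u₁ ℕ.* 0 ℕ.+ (u₂ ℕ.* u₂ ℕ.* 0 ℕ.+ (u₃ ℕ.* u₃ ℕ.* 1 ℕ.+ (u₄ ℕ.* u₄ ℕ.* 1 ℕ.+ 0))) ≡
      u₃ ℕ.* u₃ ℕ.+ u₄ ℕ.* u₄
    form = ℕ-Solver.solve-∀
    both : ∀ a b → p ∣ a ℕ.* a ℕ.+ b ℕ.* b → p ∣ a × p ∣ b
    both a b p∣ = ∣a²+b²⇒∣a p%4≡3 a b p∣ ,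
      ∣a²+b²⇒∣a p%4≡3 b a (subst (p ∣_) (ℕ.+-comm (a ℕ.* a) (b ℕ.* b)) p∣)
    square-weight : ∀ u c → φ (u ℕ.* u ℕ.* toℕ (c *ₚ c)) ≡ φ (u ℕ.* toℕ c ℕ.* (u ℕ.* toℕ c))
    square-weight u c = trans (φ-*-cong {a = u ℕ.* u} refl (φ-toℕ (c *ₚ c))) (cong φ (swap u (toℕ c)))
      where
      swap : ∀ u c → u ℕ.* u ℕ.* (c ℕ.* c) ≡ u ℕ.* c ℕ.* (u ℕ.* c)
      swap = ℕ-Solver.solve-∀
    cancel-unit : ∀ u {c} → U c → p ∣ u ℕ.* toℕ c → p ∣ u
    cancel-unit u {c} unit p∣uc with euclidsLemma u (toℕ c) p-prime p∣uc
    ... | inj₁ p∣u = p∣u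
    ... | inj₂ p∣c = contradiction p∣c (U⇒∤ unit)
    no-solution : ¬ Solution B (0ₚ ∷ 0ₚ ∷ 1ₚ ∷ 1ₚ ∷ [])
    no-solution (u₁ ∷ u₂ ∷ u₃ ∷ u₄ ∷ [] , b₁ ∷ b₂ ∷ b₃ ∷ b₄ ∷ [] , b₁∈B ∷ b₂∈B ∷ _ , p∤us , p∣xs , p∣bs)
      with c₁ , unit₁ , refl ← B⊆Q b₁∈B | c₂ , unit₂ , refl ← B⊆Q b₂∈B = trivial p∤us
      where
      x₁ = toℕ u₁
      x₂ = toℕ u₂
      x₃ = toℕ u₃
      x₄ = toℕ u₄
      p∣x₃,x₄ : p ∣ x₃ × p ∣ x₄
      p∣x₃,x₄ = both x₃ x₄ (subst (p ∣_) (trans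
        (cong₂ (λ z o → x₁ ℕ.* x₁ ℕ.* z ℕ.+ (x₂ ℕ.* x₂ ℕ.* z ℕ.+ (x₃ ℕ.* x₃ ℕ.* o ℕ.+ (x₄ ℕ.* x₄ ℕ.* o ℕ.+ 0))))
          toℕ-0ₚ toℕ-1ₚ)
        (form x₁ x₂ x₃ x₄)) p∣xs)
      p∣x₁²b₁+x₂²b₂ : p ∣ x₁ ℕ.* x₁ ℕ.* toℕ b₁ ℕ.+ x₂ ℕ.* x₂ ℕ.* toℕ b₂
      p∣x₁²b₁+x₂²b₂ = ∣m+n∣n⇒∣m
        (subst (p ∣_) (sym (ℕ.+-assoc (x₁ ℕ.* x₁ ℕ.* toℕ b₁) (x₂ ℕ.* x₂ ℕ.* toℕ b₂) _)) p∣bs)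
        (∣m∣n⇒∣m+n (∣m⇒∣m*n (toℕ b₃) (∣m⇒∣m*n x₃ (proj₁ p∣x₃,x₄)))
          (∣m∣n⇒∣m+n (∣m⇒∣m*n (toℕ b₄) (∣m⇒∣m*n x₄ (proj₂ p∣x₃,x₄))) (divides 0 refl)))
      p∣x₁c₁,x₂c₂ : p ∣ x₁ ℕ.* toℕ c₁ × p ∣ x₂ ℕ.* toℕ c₂
      p∣x₁c₁,x₂c₂ = both (x₁ ℕ.* toℕ c₁) (x₂ ℕ.* toℕ c₂)
        (φ≡⇒∣ (φ-+-cong (square-weight x₁ c₁) (square-weight x₂ c₂)) p∣x₁²b₁+x₂²b₂)
      trivial : ¬ Any (λ u → p ∤ toℕ u) (u₁ ∷ u₂ ∷ u₃ ∷ u₄ ∷ [])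
      trivial (here p∤u₁)                         = p∤u₁ (cancel-unit x₁ unit₁ (proj₁ p∣x₁c₁,x₂c₂))
      trivial (there (here p∤u₂))                 = p∤u₂ (cancel-unit x₂ unit₂ (proj₂ p∣x₁c₁,x₂c₂))
      trivial (there (there (here p∤u₃)))         = p∤u₃ (proj₁ p∣x₃,x₄)
      trivial (there (there (there (here p∤u₄)))) = p∤u₄ (proj₂ p∣x₃,x₄)

  -- The values of the constant

  D≔4⊎D≔5 : ∀ {B} → Nonempty B → 0ₚ ∉ B → (D B ≔ 4) ⊎ (D B ≔ 5)
  D≔4⊎D≔5 {B} B≢∅ 0∉B = decide (allHave? B≢∅ 4)
    where
    decide : Dec (AllHaveZeroSumSubsequence B 4) → (D B ≔ 4) ⊎ (D B ≔ 5)
    decide (yes all) = inj₁ (D≔suc all (¬allHave-3 B≢∅ 0∉B))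
    decide (no ¬all) = inj₂ (D≔suc (allHave-5 B≢∅) ¬all)

  D≔5 : ∀ {B} → p % 4 ≡ 3 → Nonempty B → (∀ {b} → b ∈ B → Q b) → D B ≔ 5
  D≔5 p%4≡3 B≢∅ B⊆Q = D≔suc (allHave-5 B≢∅) (¬allHave-4 p%4≡3 B≢∅ B⊆Q)

theorem5p5 : (p : ℕ) (p-prime : Prime p) → 2 ∤ p → (B : Subset p) → Nonempty B →
    let open ModP p {{prime⇒nonZero p-prime}} in
    (p % 4 ≡ 1 → 0ₚ ∉ B → (D B ≔ 4) ⊎ (D B ≔ 5)) ×
    (p % 4 ≡ 3 → (∀ {b} → b ∈ B → Q b) → D B ≔ 5)
theorem5p5 0 p-prime = contradiction p-prime ¬prime[0]
theorem5p5 1 p-prime = contradiction p-prime ¬prime[1]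
theorem5p5 2 _ 2∤2 = contradiction (divides 1 refl) 2∤2
-- Matching three successors makes `2 < p` immediate.
theorem5p5 (suc (suc (suc r))) p-prime _ B B≢∅ =
  (λ _ 0∉B → D≔4⊎D≔5 B≢∅ 0∉B) , (λ p%4≡3 B⊆Q → D≔5 p%4≡3 B≢∅ B⊆Q)
  where open OddPrime (3 ℕ.+ r) p-prime (s≤s (s≤s (s≤s z≤n)))
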